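{- Let $\theta,\delta$ be congruences of $\mathbf{L}_n$ with $\theta\vee\delta\ne\{0,\dots,n\}^2$. Then $\theta\circ\delta=\delta\circ\theta=\theta\vee\delta$.
   Context: For an integer $n\ge 1$, the line $\mathbf{L}_n$ is the frame $\langle\{0,\dots,n\},R\rangle$ where $x\mathrel{R}y$ iff $|x-y|\le 1$. A congruence of $\mathbf{L}_n$ is an equivalence relation $\theta$ on $\{0,\dots,n\}$ such that whenever $x'\mathrel{\theta}x$ and $x\mathrel{R}y$ there is $y'$ with $x'\mathrel{R}y'$ and $y'\mathrel{\theta}y$. The join $\theta\vee\delta$ is the equivalence relation generated by $\theta\cup\delta$; $\circ$ denotes relational composition. -}

module Defs where

open import Level using (0ℓ)
open import Data.Nat using (ℕ; suc; _≤_)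
open import Data.Nat.Properties using ()
open import Data.Fin using (Fin; toℕ)
open import Data.Product using (Σ; ∃; _×_; _,_)
open import Data.Sum using (_⊎_)
open import Relation.Binary.Core using (Rel)
open import Relation.Binary.Structures using (IsEquivalence)
open import Relation.Binary.Construct.Closure.ReflexiveTransitive using (Star)

dist : ℕ → ℕ → ℕ
dist 0 b = b
dist (suc a) 0 = suc a
dist (suc a) (suc b) = dist a b

Pt : ℕ → Set
Pt n = Fin (suc n)

-- accessibility relation of the line L_n : x R y iff |x - y| ≤ 1
LR : (n : ℕ) → Rel (Pt n) 0ℓ
LR n x y = dist (toℕ x) (toℕ y) ≤ 1

record IsCongruence (n : ℕ) (θ : Rel (Pt n) 0ℓ) : Set where
  field
    isEquivalence : IsEquivalence θ
    compatible : ∀ {x' x y} → θ x' x → LR n x y → ∃ λ y' → LR n x' y' × θ y' y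

_∘ᵣ_ : {A : Set} → Rel A 0ℓ → Rel A 0ℓ → Rel A 0ℓ
(θ ∘ᵣ δ) x y = ∃ λ z → θ x z × δ z y

-- join: the equivalence relation generated by θ ∪ δ
-- (reflexive-transitive closure of the symmetric relation θ ∪ δ ∪ (θ ∪ δ)⁻¹)
_∨ᵣ_ : {A : Set} → Rel A 0ℓ → Rel A 0ℓ → Rel A 0ℓ
(θ ∨ᵣ δ) = Star (λ x y → (θ x y ⊎ δ x y) ⊎ (θ y x ⊎ δ y x))

_≐_ : {A : Set} → Rel A 0ℓ → Rel A 0ℓ → Set
ρ ≐ σ = (∀ {x y} → ρ x y → σ x y) × (∀ {x y} → σ x y → ρ x y)

Full : {A : Set} → Rel A 0ℓ → Set
Full ρ = ∀ x y → ρ x y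

{-# OPTIONS --safe #-}
module Submission where

-- A congruence of the line need not be decidable, but any two given pairs
-- x θ z, z δ y lie in finitely generated, hence decidable, congruences θ′ ⊆ θ
-- and δ′ ⊆ δ that are both contained in a decidable, non-full congruence J.
-- Consider the oriented edges not collapsed by J ("flags"). Walking back and
-- forth along the line, crossing any edges collapsed by J and bouncing at the
-- two ends, is a map t on flags with a single cycle, and every congruence
-- contained in J is t-invariant. Equivalences invariant under a transitive
-- abelian action commute; so θ′ and δ′ commute on flags, and hence on points
-- because every point is the source of a flag and flags lift along
-- congruences contained in J.

open import Defs
open import Level using (0ℓ)
open import Data.Bool using (Bool; true; false; not)
open import Data.Bool.Properties using (¬-not) renaming (_≟_ to _≟ᵇ_)
open import Data.Empty using (⊥-elim)
open import Data.Fin using (zero; suc; toℕ; fromℕ<; opposite; combine; inject₁)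
open import Data.Fin.Induction using (<-weakInduction)
open import Data.Fin.Properties
  using (any?; toℕ-injective; toℕ-fromℕ<; toℕ≤pred[n]; toℕ-inject₁; opposite-prop;
         opposite-involutive; combine-injective; sequence; _≟_)
open import Data.Fin.Subset using (Subset; _∈_; _∪_; ⁅_⁆; ⊥; _⊃_)
open import Data.Fin.Subset.Induction using (⊃-wellFounded; Acc; acc)
open import Data.Fin.Subset.Properties
  using (_∈?_; ∉⊥; x∈⁅x⁆; x∈⁅y⁆⇒x≡y; p⊆p∪q; q⊆p∪q; x∈p∪q⁻)
open import Data.Nat using (ℕ; zero; suc; _+_; _*_; _≤_; z≤n; s≤s; _≤?_)
open import Data.Nat.GeneralisedArithmetic using (fold; fold-+)
open import Data.Nat.Properties
  using (m+[n∸m]≡n; +-comm; +-suc; +-cancelˡ-≡; suc-injective; ≤-refl; ≤-reflexive; ≤-trans;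
         m≤n⇒m<n∨m≡n; m≤n⇒m≤1+n; 1+n≢0; n≤0⇒n≡0; <⇒≤; <⇒≱; ≤-pred)
open import Data.Product using (Σ; ∃; ∃₂; _×_; _,_; proj₁; proj₂)
open import Data.Sum using (_⊎_; inj₁; inj₂; swap; [_,_]; map₂) renaming (map to map⊎)
import Data.Sum.Effectful.Left as Left
open import Function using (_∘_)
open import Relation.Binary.Construct.Closure.ReflexiveTransitive
  using (ε; _◅_; _◅◅_; reverse; map)
open import Relation.Binary.Core using (Rel)
open import Relation.Binary.Definitions using (Decidable)
open import Relation.Binary.PropositionalEquality
  using (_≡_; refl; sym; trans; cong; subst; subst₂; isEquivalence; module ≡-Reasoning)
open import Relation.Binary.Structures using (IsEquivalence)
open import Relation.Nullary using (¬_; Dec; yes; no; ¬?)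
open import Relation.Nullary.Decidable using (_⊎-dec_; _×-dec_; decidable-stable)

-- Congruences and the neighbour relation of the line

module Congruence {n : ℕ} {θ : Rel (Pt n) 0ℓ} (C : IsCongruence n θ) where
  open IsCongruence C public using (compatible)
  open IsEquivalence (IsCongruence.isEquivalence C) public
    renaming (refl to θ-refl; sym to θ-sym; trans to θ-trans)

≡-isCongruence : ∀ n → IsCongruence n _≡_
≡-isCongruence n = record
  { isEquivalence = isEquivalence
  ; compatible = λ { {y = y} refl r → y , r , refl }
  }

dist-refl : ∀ a → dist a a ≤ 1
dist-refl zero = z≤n
dist-refl (suc a) = dist-refl a

dist-suc : ∀ a → dist (suc a) a ≤ 1
dist-suc zero = ≤-refl
dist-suc (suc a) = dist-suc a

dist-comm : ∀ a b → dist a b ≡ dist b a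
dist-comm zero zero = refl
dist-comm zero (suc b) = refl
dist-comm (suc a) zero = refl
dist-comm (suc a) (suc b) = dist-comm a b

dist≤1 : ∀ a b → dist a b ≤ 1 → a ≡ b ⊎ a ≡ suc b ⊎ b ≡ suc a
dist≤1 zero zero _ = inj₁ refl
dist≤1 zero (suc zero) _ = inj₂ (inj₂ refl)
dist≤1 zero (suc (suc b)) (s≤s ())
dist≤1 (suc zero) zero _ = inj₂ (inj₁ refl)
dist≤1 (suc (suc a)) zero (s≤s ())
dist≤1 (suc a) (suc b) p with dist≤1 a b p
... | inj₁ e = inj₁ (cong suc e)
... | inj₂ (inj₁ e) = inj₂ (inj₁ (cong suc e))
... | inj₂ (inj₂ e) = inj₂ (inj₂ (cong suc e))

LR-refl : ∀ {n} (x : Pt n) → LR n x x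
LR-refl x = dist-refl (toℕ x)

LR-sym : ∀ {n} {x y : Pt n} → LR n x y → LR n y x
LR-sym {x = x} {y} = subst (_≤ 1) (dist-comm (toℕ x) (toℕ y))

-- The property is carried from `x` down to 0 and from there up to any `y`.
LR-connected : ∀ {n} (P : Pt n → Set) → (∀ {x y} → P x → LR n x y → P y) →
               ∀ {x} → P x → ∀ y → P y
LR-connected {n} P step {x} px =
  <-weakInduction P (<-weakInduction (λ i → P i → P zero) (λ p → p) (λ i f p → f (step p (down i))) x px)
    (λ i p → step p (LR-sym {n} {suc i} {inject₁ i} (down i)))
  where
  down : ∀ i → LR n (suc i) (inject₁ i)
  down i = subst (λ k → dist (suc (toℕ i)) k ≤ 1) (sym (toℕ-inject₁ i)) (dist-suc (toℕ i))

-- Directions and ranks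

-- Direction true heads for 0 and false for n; rank counts the remaining steps.
rank : ∀ {n} → Bool → Pt n → ℕ
rank true x = toℕ x
rank false x = toℕ (opposite x)

Adj : ∀ {n} → Bool → Rel (Pt n) 0ℓ
Adj d x y = rank d x ≡ suc (rank d y)

rank-sum : ∀ {n} d (x : Pt n) → rank d x + rank (not d) x ≡ n
rank-sum true x = trans (cong (toℕ x +_) (opposite-prop x)) (m+[n∸m]≡n (toℕ≤pred[n] x))
rank-sum false x = trans (+-comm (rank false x) (toℕ x)) (rank-sum true x)

rank-injective : ∀ {n} d {x y : Pt n} → rank d x ≡ rank d y → x ≡ y
rank-injective true e = toℕ-injective e
rank-injective false {x} {y} e =
  trans (sym (opposite-involutive x)) (trans (cong opposite (toℕ-injective e)) (opposite-involutive y))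

rank≤n : ∀ {n} d (x : Pt n) → rank d x ≤ n
rank≤n true x = toℕ≤pred[n] x
rank≤n false x = toℕ≤pred[n] (opposite x)

rank-suc⇒Adj : ∀ {n} d {x : Pt n} {m} → rank d x ≡ suc m → ∃ (Adj d x)
rank-suc⇒Adj {n} d {x} {m} e = at d e
  where
  m<1+n : suc m ≤ suc n
  m<1+n = m≤n⇒m≤1+n (≤-trans (≤-reflexive (sym e)) (rank≤n d x))
  at : ∀ d → rank d x ≡ suc m → ∃ (Adj d x)
  at true e = fromℕ< m<1+n , trans e (cong suc (sym (toℕ-fromℕ< m<1+n)))
  at false e = opposite (fromℕ< m<1+n) ,
    trans e (cong suc (sym (trans (cong toℕ (opposite-involutive (fromℕ< m<1+n))) (toℕ-fromℕ< m<1+n))))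

rank-not-max : ∀ {n} d {x : Pt n} → rank d x ≡ 0 → ∀ y → rank (not d) y ≤ rank (not d) x
rank-not-max d {x} e y =
  ≤-trans (rank≤n (not d) y) (≤-reflexive (trans (sym (rank-sum d x)) (cong (_+ rank (not d) x) e)))

-- The ranks in the two directions add up to `n`, so one falls by 1 exactly when the other rises by
-- 1.
Adj-not : ∀ {n} d {x y : Pt n} → Adj d x y → Adj (not d) y x
Adj-not d {x} {y} e = +-cancelˡ-≡ (rank d y) _ _ (begin
  rank d y + rank (not d) y         ≡⟨ rank-sum d y ⟩
  _                                 ≡⟨ rank-sum d x ⟨
  rank d x + rank (not d) x         ≡⟨ cong (_+ rank (not d) x) e ⟩
  suc (rank d y + rank (not d) x)   ≡⟨ +-suc (rank d y) (rank (not d) x) ⟨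
  rank d y + suc (rank (not d) x)   ∎)
  where open ≡-Reasoning

LR⇒Adj : ∀ {n} d {x y : Pt n} → LR n x y → x ≡ y ⊎ Adj d x y ⊎ Adj d y x
LR⇒Adj true {x} {y} r with dist≤1 (toℕ x) (toℕ y) r
... | inj₁ e = inj₁ (toℕ-injective e)
... | inj₂ s = inj₂ s
LR⇒Adj false {x} {y} r with LR⇒Adj true {x} {y} r
... | inj₁ e = inj₁ e
... | inj₂ (inj₁ a) = inj₂ (inj₂ (Adj-not true {x} {y} a))
... | inj₂ (inj₂ a) = inj₂ (inj₁ (Adj-not true {y} {x} a))

Adj⇒LR : ∀ {n} d {x y : Pt n} → Adj d x y → LR n x y
Adj⇒LR true {x} {y} a = subst (λ k → dist k (toℕ y) ≤ 1) (sym a) (dist-suc (toℕ y))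
Adj⇒LR {n} false {x} {y} a = LR-sym {n} {y} {x} (Adj⇒LR true {y} {x} (Adj-not false {x} {y} a))

Adj-injective : ∀ {n} d {x x′ y : Pt n} → Adj d x y → Adj d x′ y → x ≡ x′
Adj-injective d a b = rank-injective d (trans a (sym b))

Adj-functional : ∀ {n} d {x y y′ : Pt n} → Adj d x y → Adj d x y′ → y ≡ y′
Adj-functional d a b = rank-injective d (suc-injective (trans (sym a) b))

-- The walk on flags and its invariance

module Flags {n : ℕ} {J : Rel (Pt n) 0ℓ} (JC : IsCongruence n J) (J? : Decidable J)
             (¬full : ¬ Full J) where
  open Congruence JC

  -- If all neighbours of `z` lay in its class, compatibility would match any neighbour of a class
  -- member with a neighbour of `z`; the class would be closed under `LR`, hence the whole line.
  exit : ∀ z → ∃ λ z′ → LR n z z′ × ¬ J z z′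
  exit z with any? (λ z′ → (dist (toℕ z) (toℕ z′) ≤? 1) ×-dec ¬? (J? z z′))
  ... | yes p = p
  ... | no none = ⊥-elim (¬full λ x y → θ-trans (θ-sym (all x)) (all y))
    where
    stays : ∀ {y} → LR n z y → J z y
    stays {y} r = decidable-stable (J? z y) λ ¬j → none (y , r , ¬j)
    all : ∀ y → J z y
    all = LR-connected (J z)
      (λ j r → let (t , zt , ty) = compatible j r in θ-trans (stays zt) ty) θ-refl

  -- The walk crosses the J-cut edge u v, then moves to a inside the J-class
  -- of v (a = v unless the walk has to cross an edge inside that class) and
  -- leaves the class along the edge a b.
  record Next (u v a b : Pt n) : Set where
    field
      va : LR n v a
      Jva : J v a
      ab : LR n a b
      ¬Jvb : ¬ J v b
      inside : ∀ {y} → LR n v y → J v y → y ≡ v ⊎ y ≡ a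
      outside : ∀ {y} → LR n a y → ¬ J v y → y ≡ b ⊎ y ≡ u

  module _ {θ : Rel (Pt n) 0ℓ} (θC : IsCongruence n θ) (θ⊆J : ∀ {x y} → θ x y → J x y) where
    private module θ = Congruence θC

    private
      -- Compatibility matches the neighbour `a` of `v` with a neighbour `y` of `q`. Since `θ` lies
      -- in `J`, `y` is in the class of `q`, where `inside` leaves two candidates.
      half-a : ∀ {u v a b p q a′ b′} → Next u v a b → Next p q a′ b′ →
               θ v q → θ a q ⊎ θ a a′
      half-a N M vq with θ.compatible (θ.θ-sym vq) (Next.va N)
      ... | y , qy , ya with Next.inside M qy
                 (θ-trans (θ⊆J (θ.θ-sym vq)) (θ-trans (Next.Jva N) (θ-sym (θ⊆J ya))))
      ... | inj₁ refl = inj₁ (θ.θ-sym ya)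
      ... | inj₂ refl = inj₂ (θ.θ-sym ya)

      -- Here `b` is matched with a neighbour of `a′` outside the class of `q`, and `outside` leaves
      -- two candidates.
      half-b : ∀ {u v a b p q a′ b′} → Next u v a b → Next p q a′ b′ →
               θ v q → θ a a′ → θ b b′ ⊎ θ b p
      half-b N M vq aa′ with θ.compatible (θ.θ-sym aa′) (Next.ab N)
      ... | y , a′y , yb with Next.outside M a′y
                 (λ qy → Next.¬Jvb N (θ-trans (θ⊆J vq) (θ-trans qy (θ⊆J yb))))
      ... | inj₁ refl = inj₁ (θ.θ-sym yb)
      ... | inj₂ refl = inj₂ (θ.θ-sym yb)

    Next-preserves : ∀ {u v a b p q a′ b′} → Next u v a b → Next p q a′ b′ →
                     θ u p → θ v q → θ a a′ × θ b b′
    Next-preserves {u} {v} {a} {b} {p} {q} {a′} {b′} N M up vq = aa′ , bb′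
      where
      -- If a and a′ are not matched directly, then a θ q and a′ θ v, and v θ q
      -- closes the gap; likewise for b with u θ p.
      aa′ : θ a a′
      aa′ with half-a N M vq | half-a M N (θ.θ-sym vq)
      ... | inj₂ r | _ = r
      ... | inj₁ _ | inj₂ r = θ.θ-sym r
      ... | inj₁ r | inj₁ s = θ.θ-trans r (θ.θ-trans (θ.θ-sym vq) (θ.θ-sym s))
      bb′ : θ b b′
      bb′ with half-b N M vq aa′ | half-b M N (θ.θ-sym vq) (θ.θ-sym aa′)
      ... | inj₁ r | _ = r
      ... | inj₂ _ | inj₁ r = θ.θ-sym r
      ... | inj₂ r | inj₂ s = θ.θ-trans r (θ.θ-trans (θ.θ-sym up) (θ.θ-sym s))

  record Flag : Set where
    constructor flag
    field
      dir : Bool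
      src tgt : Pt n
      edge : Adj dir src tgt
      cut : ¬ J src tgt
  open Flag

  lift-flag : ∀ {x y} → LR n x y → ¬ J x y → ∃ λ e → src e ≡ x × tgt e ≡ y
  lift-flag {x} {y} r ¬j with LR⇒Adj true {x} {y} r
  ... | inj₁ refl = ⊥-elim (¬j θ-refl)
  ... | inj₂ (inj₁ a) = flag true x y a ¬j , refl , refl
  ... | inj₂ (inj₂ a) = flag false x y (Adj-not true {y} {x} a) ¬j , refl , refl

  -- `Next` holds what invariance needs; `Advance` keeps the direction and position of the new
  -- source, from which the single cycle is traced.
  data Advance (e e′ : Flag) : Set where
    forward : dir e′ ≡ dir e → Adj (dir e) (src e) (src e′) → Advance e e′
    across : dir e′ ≡ dir e → J (tgt e) (src e′) → Adj (dir e) (tgt e) (src e′) → Advance e e′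
    turn : dir e′ ≡ not (dir e) → rank (dir e) (src e′) ≡ 0 → src e′ ≡ tgt e → Advance e e′

  successor : ∀ e → ∃ λ e′ → Next (src e) (tgt e) (src e′) (tgt e′) × Advance e e′
  successor (flag d u v uv ¬Juv) = go (rank d v) refl
    where
    ¬Jvu : ¬ J v u
    ¬Jvu = ¬Juv ∘ θ-sym
    Result : Set
    Result = ∃ λ e′ → Next u v (src e′) (tgt e′) × Advance (flag d u v uv ¬Juv) e′

    go : ∀ m → rank d v ≡ m → Result
    -- At the end of the line `u` is the only proper neighbour of `v`, so the walk bounces: `a` is
    -- `v` and `b` is `u`.
    go zero v0 = flag (not d) v u (Adj-not d {u} {v} uv) ¬Jvu ,
      record { va = LR-refl v ; Jva = θ-refl ; ab = LR-sym {n} {u} {v} (Adj⇒LR d {u} {v} uv) ; ¬Jvb = ¬Jvu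
             ; inside = ins ; outside = out } ,
      turn refl v0 refl
      where
      nbr : ∀ {y} → LR n v y → y ≡ v ⊎ y ≡ u
      nbr {y} r with LR⇒Adj d {v} {y} r
      ... | inj₁ refl = inj₁ refl
      ... | inj₂ (inj₁ vy) = ⊥-elim (1+n≢0 (trans (sym vy) v0))
      ... | inj₂ (inj₂ yv) = inj₂ (Adj-injective d {y} {u} {v} yv uv)
      ins : ∀ {y} → LR n v y → J v y → y ≡ v ⊎ y ≡ v
      ins r j with nbr r
      ... | inj₁ p = inj₁ p
      ... | inj₂ refl = ⊥-elim (¬Jvu j)
      out : ∀ {y} → LR n v y → ¬ J v y → y ≡ u ⊎ y ≡ u
      out r ¬j with nbr r
      ... | inj₁ refl = ⊥-elim (¬j θ-refl)
      ... | inj₂ p = inj₂ p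
    go (suc m) v1 with rank-suc⇒Adj d {v} v1
    ... | w , vw = beyond (J? v w)
      where
      nbr : ∀ {y} → LR n v y → y ≡ v ⊎ y ≡ w ⊎ y ≡ u
      nbr {y} r with LR⇒Adj d {v} {y} r
      ... | inj₁ refl = inj₁ refl
      ... | inj₂ (inj₁ vy) = inj₂ (inj₁ (Adj-functional d {v} {y} {w} vy vw))
      ... | inj₂ (inj₂ yv) = inj₂ (inj₂ (Adj-injective d {y} {u} {v} yv uv))
      beyond : Dec (J v w) → Result
      beyond (no ¬Jvw) = flag d v w vw ¬Jvw ,
        record { va = LR-refl v ; Jva = θ-refl ; ab = Adj⇒LR d {v} {w} vw ; ¬Jvb = ¬Jvw
               ; inside = ins ; outside = out } ,
        forward refl uv
        where
        ins : ∀ {y} → LR n v y → J v y → y ≡ v ⊎ y ≡ v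
        ins r j with nbr r
        ... | inj₁ p = inj₁ p
        ... | inj₂ (inj₁ refl) = ⊥-elim (¬Jvw j)
        ... | inj₂ (inj₂ refl) = ⊥-elim (¬Jvu j)
        out : ∀ {y} → LR n v y → ¬ J v y → y ≡ w ⊎ y ≡ u
        out r ¬j with nbr r
        ... | inj₁ refl = ⊥-elim (¬j θ-refl)
        ... | inj₂ p = p
      -- The way out of the class at `w` cannot lead back to `v`, so it leads onward. Thus two
      -- consecutive edges are never both collapsed, and one crossing suffices.
      beyond (yes Jvw) with exit w
      ... | x , wx , ¬Jwx with LR⇒Adj d {w} {x} wx
      ... | inj₁ refl = ⊥-elim (¬Jwx θ-refl)
      ... | inj₂ (inj₂ xw) =
        ⊥-elim (¬Jwx (subst (J w) (Adj-injective d {v} {x} {w} vw xw) (θ-sym Jvw)))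
      ... | inj₂ (inj₁ w→x) = flag d w x w→x ¬Jwx ,
        record { va = Adj⇒LR d {v} {w} vw ; Jva = Jvw ; ab = wx
               ; ¬Jvb = λ j → ¬Jwx (θ-trans (θ-sym Jvw) j)
               ; inside = ins ; outside = out } ,
        across refl Jvw vw
        where
        ins : ∀ {y} → LR n v y → J v y → y ≡ v ⊎ y ≡ w
        ins r j with nbr r
        ... | inj₁ p = inj₁ p
        ... | inj₂ (inj₁ p) = inj₂ p
        ... | inj₂ (inj₂ refl) = ⊥-elim (¬Jvu j)
        out : ∀ {y} → LR n w y → ¬ J v y → y ≡ x ⊎ y ≡ u
        out {y} r ¬j with LR⇒Adj d {w} {y} r
        ... | inj₁ refl = ⊥-elim (¬j Jvw)
        ... | inj₂ (inj₁ wy) = inj₁ (Adj-functional d {w} {y} {x} wy w→x)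
        ... | inj₂ (inj₂ yw) = ⊥-elim (¬j (subst (J v) (Adj-injective d {v} {y} {w} vw yw) θ-refl))

  -- The walk has a single cycle

  next : Flag → Flag
  next e = proj₁ (successor e)

  -- Propositional equality would also compare the proofs in `edge` and `cut`; the endpoints already
  -- determine the direction.
  _≈_ : Rel Flag 0ℓ
  e ≈ g = src e ≡ src g × tgt e ≡ tgt g

  record _⟶_ (e g : Flag) : Set where
    constructor reach
    field
      steps : ℕ
      hits : fold e next steps ≈ g

  module _ {θ : Rel (Pt n) 0ℓ} (θC : IsCongruence n θ) (θ⊆J : ∀ {x y} → θ x y → J x y) where
    fold-next-preserves : ∀ s {e g} → θ (src e) (src g) → θ (tgt e) (tgt g) →
      θ (src (fold e next s)) (src (fold g next s)) × θ (tgt (fold e next s)) (tgt (fold g next s))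
    fold-next-preserves zero p q = p , q
    fold-next-preserves (suc s) {e} {g} p q with fold-next-preserves s {e} {g} p q
    ... | p′ , q′ = Next-preserves θC θ⊆J (proj₁ (proj₂ (successor (fold e next s))))
                      (proj₁ (proj₂ (successor (fold g next s)))) p′ q′

  -- Invariance applied to equality, itself a congruence inside `J`, shows that the walk respects
  -- `_≈_`.
  fold-next-≈ : ∀ s {e g} → e ≈ g → fold e next s ≈ fold g next s
  fold-next-≈ s {e} {g} (p , q) =
    fold-next-preserves (≡-isCongruence n) (λ { {x} refl → θ-refl {x} }) s {e} {g} p q

  ⟶-trans : ∀ {e g h} → e ⟶ g → g ⟶ h → e ⟶ h
  ⟶-trans {e} {g} {h} (reach s p) (reach t (q , q′)) with fold-next-≈ t {fold e next s} {g} p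
  ... | r , r′ = reach (t + s) (subst (_≈ h) (sym (fold-+ e next t)) (trans r q , trans r′ q′))

  ⟶-step : ∀ e {g} → next e ⟶ g → e ⟶ g
  ⟶-step e = ⟶-trans {e} {next e} (reach 1 (refl , refl))

  -- Between bounces the walk meets every flag of its direction that lies ahead. The bound `k` only
  -- makes the recursion structural.
  ⟶-same-dir : ∀ d k e g → dir e ≡ d → dir g ≡ d → rank d (src e) ≤ k →
               rank d (src g) ≤ rank d (src e) → e ⟶ g
  ⟶-same-dir d k e@(flag d u v uv ¬Juv) g@(flag _ p q pq ¬Jpq) refl refl u≤k p≤u
    with m≤n⇒m<n∨m≡n p≤u
  ... | inj₂ p≡u with rank-injective d {p} {u} p≡u
  ...   | refl = reach 0 (refl , Adj-functional d {u} {v} {q} uv pq)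
  ⟶-same-dir d zero e@(flag d u v uv ¬Juv) g refl refl u≤0 p≤u | inj₁ p<u =
    ⊥-elim (<⇒≱ p<u (≤-trans u≤0 z≤n))
  ⟶-same-dir d (suc k) e@(flag d u v uv ¬Juv) g@(flag _ p q pq ¬Jpq) refl refl u≤k p≤u | inj₁ p<u
    with proj₂ (proj₂ (successor e))
  ... | forward same ua =
    ⟶-step e (⟶-same-dir d k (next e) g same refl (≤-pred (subst (_≤ suc k) ua u≤k))
      (≤-pred (subst (suc (rank d p) ≤_) ua p<u)))
  ... | across same Jva va =
    ⟶-step e (⟶-same-dir d k (next e) g same refl
      (≤-trans (<⇒≤ (≤-reflexive (sym va))) (≤-pred (subst (_≤ suc k) uv u≤k))) p≤a)
    where
    p≤a : rank d p ≤ rank d (src (next e))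
    p≤a with m≤n⇒m<n∨m≡n (≤-pred (subst (suc (rank d p) ≤_) uv p<u))
    ... | inj₁ p<v = ≤-pred (subst (suc (rank d p) ≤_) va p<v)
    -- Crossing a collapsed edge skips only the source `v`, and `g` cannot start there: its edge
    -- would be the collapsed one.
    ... | inj₂ p≡v with rank-injective d {p} {v} p≡v
    ...   | refl = ⊥-elim (¬Jpq (subst (J v) (Adj-functional d {v} {_} {q} va pq) Jva))
  ... | turn _ a0 a≡v =
    ⊥-elim (1+n≢0 (trans (sym pq) (n≤0⇒n≡0
      (≤-pred (subst (suc (rank d p) ≤_) (trans uv (cong suc (trans (cong (rank d) (sym a≡v)) a0))) p<u)))))

  -- The walk loses rank until it bounces. By `rank-not-max`, all flags of the new direction then
  -- lie ahead.
  ⟶-turn : ∀ d k e → dir e ≡ d → rank d (src e) ≤ k →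
           ∃ λ e′ → dir e′ ≡ not d × rank d (src e′) ≡ 0 × e ⟶ e′
  ⟶-turn d zero (flag d u v uv ¬Juv) refl u≤0 = ⊥-elim (1+n≢0 (trans (sym uv) (n≤0⇒n≡0 u≤0)))
  ⟶-turn d (suc k) e@(flag d u v uv ¬Juv) refl u≤k with proj₂ (proj₂ (successor e))
  ... | turn flipped a0 _ = next e , flipped , a0 , reach 1 (refl , refl)
  ... | forward same ua with ⟶-turn d k (next e) same (≤-pred (subst (_≤ suc k) ua u≤k))
  ...   | e′ , fl , r0 , path = e′ , fl , r0 , ⟶-step e path
  ⟶-turn d (suc k) e@(flag d u v uv ¬Juv) refl u≤k | across same _ va
    with ⟶-turn d k (next e) same (≤-trans (<⇒≤ (≤-reflexive (sym va))) (≤-pred (subst (_≤ suc k) uv u≤k)))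
  ...   | e′ , fl , r0 , path = e′ , fl , r0 , ⟶-step e path

  ⟶-opposite-dir : ∀ e g → dir g ≡ not (dir e) → e ⟶ g
  ⟶-opposite-dir e g opp with ⟶-turn (dir e) _ e refl ≤-refl
  ... | e′ , flipped , r0 , path =
    ⟶-trans {e} {e′} path (⟶-same-dir (not (dir e)) _ e′ g flipped opp ≤-refl
      (rank-not-max (dir e) {src e′} r0 (src g)))

  -- One bounce reaches every flag of the opposite direction; a second one reaches those of the
  -- original direction.
  ⟶-total : ∀ e g → e ⟶ g
  ⟶-total e g with dir g ≟ᵇ not (dir e)
  ... | yes opp = ⟶-opposite-dir e g opp
  ... | no ¬opp with ⟶-turn (dir e) _ e refl ≤-refl
  ...   | e′ , flipped , _ , path = ⟶-trans {e} {e′} path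
    (⟶-opposite-dir e′ g (trans (¬-not ¬opp) (cong not (sym flipped))))

  -- Commutation below a decidable non-full congruence

  module _ {θ δ : Rel (Pt n) 0ℓ} (θC : IsCongruence n θ) (δC : IsCongruence n δ)
           (θ⊆J : ∀ {x y} → θ x y → J x y) (δ⊆J : ∀ {x y} → δ x y → J x y) where
    private
      module θ = Congruence θC
      module δ = Congruence δC

      fold-next-swap : ∀ g s v → fold (fold g next v) next s ≡ fold (fold g next s) next v
      fold-next-swap g s v =
        trans (sym (fold-+ g next s)) (trans (cong (fold g next) (+-comm s v)) (fold-+ g next v))

    -- If e = tˢ g and h = tᵛ g, the intermediate flag is tᵛ e = tˢ h.
    commute-flags : ∀ e g h → θ (src e) (src g) → θ (tgt e) (tgt g) →
                    δ (src g) (src h) → δ (tgt g) (tgt h) →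
                    g ⟶ e → g ⟶ h → (δ ∘ᵣ θ) (src e) (src h)
    commute-flags e g h θs θt δs δt (reach s ge) (reach v gh) =
      src (fold e next v) ,
      subst₂ δ (proj₁ ge) (trans (sym (proj₁ tˢtᵛg≈tˢh)) (proj₁ tˢtᵛg≈tᵛe))
        (proj₁ (fold-next-preserves δC δ⊆J s {g} {h} δs δt)) ,
      subst (θ _) (proj₁ gh) (proj₁ (fold-next-preserves θC θ⊆J v {e} {g} θs θt))
      where
      tˢtᵛg≈tˢh : fold (fold g next v) next s ≈ fold h next s
      tˢtᵛg≈tˢh = fold-next-≈ s {fold g next v} {h} gh
      tˢtᵛg≈tᵛe : fold (fold g next v) next s ≈ fold e next v
      tˢtᵛg≈tᵛe = subst (_≈ fold e next v) (sym (fold-next-swap g s v))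
        (fold-next-≈ v {fold g next s} {e} ge)

    -- An edge leaving the class of `z` is transported to `x` along `θ` and to `y` along `δ`. Its
    -- images are again cut, their ends being `J`-related to those of a cut edge.
    commute-under : ∀ {x z y} → θ x z → δ z y → (δ ∘ᵣ θ) x y
    commute-under {x} {z} {y} xz zy with exit z
    ... | z′ , zz′ , ¬Jzz′ with θ.compatible xz zz′ | δ.compatible (δ.θ-sym zy) zz′
    ... | x′ , xx′ , x′z′ | y′ , yy′ , y′z′
      with lift-flag {x} {x′} xx′ (λ j → ¬Jzz′ (θ-trans (θ-sym (θ⊆J xz)) (θ-trans j (θ⊆J x′z′))))
         | lift-flag {z} {z′} zz′ ¬Jzz′
         | lift-flag {y} {y′} yy′ (λ j → ¬Jzz′ (θ-trans (δ⊆J zy) (θ-trans j (δ⊆J y′z′))))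
    ... | e , refl , refl | g , refl , refl | h , refl , refl =
      commute-flags e g h xz x′z′ zy (δ.θ-sym y′z′) (⟶-total g e) (⟶-total g h)

-- Decidable congruences inside an arbitrary one

module Saturation {n : ℕ} {K : Rel (Pt n) 0ℓ} (KC : IsCongruence n K)
                  {D₀ : Rel (Pt n) 0ℓ} (D₀? : Decidable D₀) (D₀⊆K : ∀ {x y} → D₀ x y → K x y) where
  open Congruence KC

  -- The added pairs are coded in a finite `Subset`, so that enlarging it is well founded.
  _∪ᵣ_ : Rel (Pt n) 0ℓ → Subset (suc n * suc n) → Rel (Pt n) 0ℓ
  (ρ ∪ᵣ p) x y = ρ x y ⊎ combine x y ∈ p

  Missing : Subset (suc n * suc n) → Set
  Missing p = ∃₂ λ x y → K x y × ¬ (D₀ ∪ᵣ p) x y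

  module _ (p : Subset (suc n * suc n)) where
    private
      D = D₀ ∪ᵣ p

    D? : Decidable D
    D? x y = D₀? x y ⊎-dec (combine x y ∈? p)

    check : ∀ {x y} → K x y → Missing p ⊎ D x y
    check {x} {y} k with D? x y
    ... | yes d = inj₂ d
    ... | no ¬d = inj₁ (x , y , k , ¬d)

    all : ∀ {P : Pt n → Set} → (∀ x → Missing p ⊎ P x) → Missing p ⊎ (∀ x → P x)
    all = sequence (Left.applicative (Missing p) 0ℓ)

    -- `K` is never decided. Each instance of a congruence law with premises in `D` yields a proof
    -- that some pair is in `K`, and only membership of that pair in `D` is tested.
    saturated-or-missing : (∀ {x y} → D x y → K x y) → Missing p ⊎ IsCongruence n D
    saturated-or-missing D⊆K
      with all (λ x → check (θ-refl {x}))
         | all (λ x → all (λ y → symm x y))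
         | all (λ x → all (λ y → all (λ z → tran x y z)))
         | all (λ x → all (λ y → all (λ z → comp x y z)))
      where
      symm : ∀ x y → Missing p ⊎ (D x y → D y x)
      symm x y with D? x y
      ... | no ¬d = inj₂ λ d → ⊥-elim (¬d d)
      ... | yes d = map₂ (λ d′ _ → d′) (check (θ-sym (D⊆K d)))
      tran : ∀ x y z → Missing p ⊎ (D x y → D y z → D x z)
      tran x y z with D? x y | D? y z
      ... | no ¬d | _ = inj₂ λ d → ⊥-elim (¬d d)
      ... | yes _ | no ¬d = inj₂ λ _ d → ⊥-elim (¬d d)
      ... | yes d | yes e = map₂ (λ d′ _ _ → d′) (check (θ-trans (D⊆K d) (D⊆K e)))
      comp : ∀ x′ x y → Missing p ⊎ (D x′ x → LR n x y → ∃ λ y′ → LR n x′ y′ × D y′ y)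
      comp x′ x y with D? x′ x | dist (toℕ x) (toℕ y) ≤? 1
      ... | no ¬d | _ = inj₂ λ d → ⊥-elim (¬d d)
      ... | yes _ | no ¬r = inj₂ λ _ r → ⊥-elim (¬r r)
      -- The witness supplied by `K` also serves for `D`, provided its pair is already there.
      ... | yes d | yes r with compatible (D⊆K d) r
      ...   | y′ , x′y′ , k = map₂ (λ d′ _ _ → y′ , x′y′ , d′) (check k)
    ... | inj₁ m | _ | _ | _ = inj₁ m
    ... | inj₂ _ | inj₁ m | _ | _ = inj₁ m
    ... | inj₂ _ | inj₂ _ | inj₁ m | _ = inj₁ m
    ... | inj₂ _ | inj₂ _ | inj₂ _ | inj₁ m = inj₁ m
    ... | inj₂ rf | inj₂ sy | inj₂ tr | inj₂ co = inj₂ record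
      { isEquivalence = record
          { refl = λ {x} → rf x ; sym = λ {x} {y} → sy x y ; trans = λ {x} {y} {z} → tr x y z }
      ; compatible = λ {x′} {x} {y} → co x′ x y
      }

  Saturated : Set₁
  Saturated = Σ (Rel (Pt n) 0ℓ) λ D → IsCongruence n D × Decidable D ×
    (∀ {x y} → D₀ x y → D x y) × (∀ {x y} → D x y → K x y)

  -- Each missing pair found is added; it was absent before, so the subset grows strictly.
  saturate : Saturated
  saturate = go ⊥ (⊃-wellFounded ⊥) λ m → ⊥-elim (∉⊥ m)
    where
    go : ∀ p → Acc _⊃_ p → (∀ {x y} → combine x y ∈ p → K x y) → Saturated
    go p (acc rs) p⊆K with saturated-or-missing p [ D₀⊆K , p⊆K ]
    ... | inj₂ c = D₀ ∪ᵣ p , c , D? p , inj₁ , [ D₀⊆K , p⊆K ]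
    ... | inj₁ (a , b , k , ¬d) = go (p ∪ ⁅ combine a b ⁆)
        (rs (p⊆p∪q ⁅ combine a b ⁆ , combine a b ,
          q⊆p∪q p ⁅ combine a b ⁆ (x∈⁅x⁆ (combine a b)) , ¬d ∘ inj₂)) p′⊆K
      where
      p′⊆K : ∀ {x y} → combine x y ∈ p ∪ ⁅ combine a b ⁆ → K x y
      p′⊆K {x} {y} m with x∈p∪q⁻ p ⁅ combine a b ⁆ m
      ... | inj₁ m′ = p⊆K m′
      ... | inj₂ m′ with combine-injective x y a b (x∈⁅y⁆⇒x≡y (combine a b) m′)
      ...   | refl , refl = k

-- Joins and the commutation theorem

∨-isCongruence : ∀ {n} {θ δ : Rel (Pt n) 0ℓ} → IsCongruence n θ → IsCongruence n δ →
                 IsCongruence n (θ ∨ᵣ δ)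
∨-isCongruence {n} {θ} {δ} θC δC = record
  { isEquivalence = record { refl = ε ; sym = reverse swap ; trans = _◅◅_ }
  ; compatible = comp
  }
  where
  module θ = Congruence θC
  module δ = Congruence δC
  Step : Rel (Pt n) 0ℓ
  Step x y = (θ x y ⊎ δ x y) ⊎ (θ y x ⊎ δ y x)
  step-comp : ∀ {x′ x y} → Step x′ x → LR n x y → ∃ λ y′ → LR n x′ y′ × Step y′ y
  step-comp (inj₁ (inj₁ s)) r = let (y′ , r′ , t) = θ.compatible s r in y′ , r′ , inj₁ (inj₁ t)
  step-comp (inj₁ (inj₂ s)) r = let (y′ , r′ , t) = δ.compatible s r in y′ , r′ , inj₁ (inj₂ t)
  step-comp (inj₂ (inj₁ s)) r = let (y′ , r′ , t) = θ.compatible (θ.θ-sym s) r in y′ , r′ , inj₁ (inj₁ t)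
  step-comp (inj₂ (inj₂ s)) r = let (y′ , r′ , t) = δ.compatible (δ.θ-sym s) r in y′ , r′ , inj₁ (inj₂ t)
  comp : ∀ {x′ x y} → (θ ∨ᵣ δ) x′ x → LR n x y → ∃ λ y′ → LR n x′ y′ × (θ ∨ᵣ δ) y′ y
  comp {y = y} ε r = y , r , ε
  comp (s ◅ ss) r with comp ss r
  ... | y″ , r″ , ts with step-comp s r″
  ...   | y′ , r′ , t = y′ , r′ , t ◅ ts

commute : ∀ {n} {θ δ : Rel (Pt n) 0ℓ} → IsCongruence n θ → IsCongruence n δ →
          ¬ Full (θ ∨ᵣ δ) → ∀ {x y} → (θ ∘ᵣ δ) x y → (δ ∘ᵣ θ) x y
commute {n} {θ} {δ} θC δC ¬full {x} {y} (z , xz , zy)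
  -- The seeds are the single pairs `x`, `z` and `z`, `y`.
  with Saturation.saturate θC (pair? x z) (λ { (refl , refl) → xz })
     | Saturation.saturate δC (pair? z y) (λ { (refl , refl) → zy })
  where
  Pair : Pt n → Pt n → Rel (Pt n) 0ℓ
  Pair a b x y = x ≡ a × y ≡ b
  pair? : ∀ a b → Decidable (Pair a b)
  pair? a b x y = (x ≟ a) ×-dec (y ≟ b)
... | θ′ , θ′C , θ′? , inθ′ , θ′⊆θ | δ′ , δ′C , δ′? , inδ′ , δ′⊆δ
  -- Seeding with the union puts both congruences inside `J`; staying inside the join keeps `J` from
  -- being full.
  with Saturation.saturate (∨-isCongruence θC δC) (λ a b → θ′? a b ⊎-dec δ′? a b)
         (λ { (inj₁ t) → inj₁ (inj₁ (θ′⊆θ t)) ◅ ε ; (inj₂ t) → inj₁ (inj₂ (δ′⊆δ t)) ◅ ε })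
... | J , JC , J? , inJ , J⊆∨
  with Flags.commute-under JC J? (λ full → ¬full λ a b → J⊆∨ (full a b)) θ′C δ′C
         (λ t → inJ (inj₁ t)) (λ t → inJ (inj₂ t)) (inθ′ (refl , refl)) (inδ′ (refl , refl))
... | w , xw , wy = w , δ′⊆δ xw , θ′⊆θ wy

theorem5p6 : (n : ℕ) → 1 ≤ n → (θ δ : Rel (Pt n) 0ℓ) → IsCongruence n θ → IsCongruence n δ → ¬ Full (θ ∨ᵣ δ) → ((θ ∘ᵣ δ) ≐ (θ ∨ᵣ δ)) × ((δ ∘ᵣ θ) ≐ (θ ∨ᵣ δ))
theorem5p6 n _ θ δ θC δC ¬full =
  (θδ⊆∨ , ∨⊆θδ) , (θδ⊆∨ ∘ δθ⊆θδ , commute θC δC ¬full ∘ ∨⊆θδ)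
  where
  module θ = Congruence θC
  module δ = Congruence δC
  ¬full′ : ¬ Full (δ ∨ᵣ θ)
  ¬full′ full = ¬full λ x y → map (map⊎ swap swap) (full x y)
  δθ⊆θδ : ∀ {x y} → (δ ∘ᵣ θ) x y → (θ ∘ᵣ δ) x y
  δθ⊆θδ = commute δC θC ¬full′
  θδ⊆∨ : ∀ {x y} → (θ ∘ᵣ δ) x y → (θ ∨ᵣ δ) x y
  θδ⊆∨ (z , xz , zy) = inj₁ (inj₁ xz) ◅ inj₁ (inj₂ zy) ◅ ε
  θ-step : ∀ {x x′ y} → θ x x′ → (θ ∘ᵣ δ) x′ y → (θ ∘ᵣ δ) x y
  θ-step t (z , x′z , zy) = z , θ.θ-trans t x′z , zy
  δ-step : ∀ {x x′ y} → δ x x′ → (θ ∘ᵣ δ) x′ y → (θ ∘ᵣ δ) x y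
  -- The new `δ`-step is commuted past the `θ`-step and merged with the final `δ`-step.
  δ-step t (z , x′z , zy) =
    let (w , xw , wz) = δθ⊆θδ (_ , t , x′z) in w , xw , δ.θ-trans wz zy
  ∨⊆θδ : ∀ {x y} → (θ ∨ᵣ δ) x y → (θ ∘ᵣ δ) x y
  ∨⊆θδ ε = _ , θ.θ-refl , δ.θ-refl
  ∨⊆θδ (inj₁ (inj₁ t) ◅ ss) = θ-step t (∨⊆θδ ss)
  ∨⊆θδ (inj₁ (inj₂ t) ◅ ss) = δ-step t (∨⊆θδ ss)
  ∨⊆θδ (inj₂ (inj₁ t) ◅ ss) = θ-step (θ.θ-sym t) (∨⊆θδ ss)
  ∨⊆θδ (inj₂ (inj₂ t) ◅ ss) = δ-step (δ.θ-sym t) (∨⊆θδ ss)
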